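{- Let $n$ be a positive integer. (a) $\mu(n,2)=\lceil 2n/3\rceil$. (b) If $n\ge 2$, then $\mu^*(n,2)=2\lceil n/3\rceil$, and this is the least even integer not less than $\mu(n,2)$.
   Context: Let $\mathbb F_2=\{0,1\}$ be the field with two elements. For $u\in\mathbb F_2^n$, $|u|$ denotes the Hamming weight of $u$ (the number of entries equal to $1$). A wiring on $n$ vertices is a matrix $W=(w_{i,j})\in M(n,n;\mathbb F_2)$ with $w_{i,i}=1$ for all $i$ (pressing button $j$ toggles bulb $i$ iff $w_{i,j}=1$). The degree of vertex $j$ is the number of $1$s in the $j$th column of $W$, and $\deg(W)$ is the maximum degree over all vertices. For $c\in\mathbb F_2^n$ (initial configuration), $M(W,c)=\max\{|Wx+c| : x\in\mathbb F_2^n\}$. For $n,m\ge1$, $A(n,m)$ is the set of wirings on $n$ vertices with $\deg(W)\le m$; for $n\ge m$, $A^*(n,m)$ is the set of wirings on $n$ vertices in which every vertex has degree exactly $m$. Define $\mu(n,m)=\min\{M(W,0): W\in A(n,m)\}$ and, for $n\ge m$, $\mu^*(n,m)=\min\{M(W,0): W\in A^*(n,m)\}$. -}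

module Defs where

open import Algebra.Definitions.RawMonoid as RawMonoid using ()
open import Data.Fin.Base using (Fin)
open import Data.Integer.Base as ℤ using ()
open import Data.Nat.Base using (ℕ; zero; suc; _≤_; _⊔_; NonZero)
open import Data.Nat.Properties using (≤-refl; ≤-trans; m≤m⊔n; m≤n⊔m; ⊔-sel)
open import Data.Parity.Base as ℙ using (Parity; 0ℙ; 1ℙ)
open import Data.Parity.Properties using (_≟_)
open import Data.Product.Base using (_×_; _,_; ∃-syntax)
open import Data.Rational.Unnormalised.Base as ℚᵘ using ()
open import Data.Sum.Base using (inj₁; inj₂)
open import Data.Vec.Base using (Vec; []; _∷_; lookup; tabulate; zipWith; replicate; count)
open import Data.Vec.Functional as Vector using ()
open import Relation.Binary.PropositionalEquality using (_≡_; refl)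

IsLeast : (ℕ → Set) → ℕ → Set
IsLeast S k = S k × (∀ l → S l → k ≤ l)

IsGreatest : (ℕ → Set) → ℕ → Set
IsGreatest S k = S k × (∀ l → S l → l ≤ k)

⌈_/_⌉ : ℕ → (d : ℕ) .{{_ : NonZero d}} → ℕ
⌈ a / d ⌉ = ℤ.∣ ℚᵘ.ceiling (ℤ.+ a ℚᵘ./ d) ∣

-- The library's two-element commutative ring ℤ/2.
𝔽₂ : Set
𝔽₂ = Parity

𝔽₂^_ : ℕ → Set
𝔽₂^ n = Vec 𝔽₂ n

Matrix : ℕ → ℕ → Set
Matrix m n = Fin m → Fin n → 𝔽₂

𝟎 : ∀ {n} → 𝔽₂^ n
𝟎 {n} = replicate n 0ℙ

infixl 6 _⊕_
infixr 7 _·_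

_⊕_ : ∀ {n} → 𝔽₂^ n → 𝔽₂^ n → 𝔽₂^ n
_⊕_ = zipWith ℙ._+_

∑ : ∀ {n} → (Fin n → 𝔽₂) → 𝔽₂
∑ = RawMonoid.sum ℙ.+-0-rawMonoid

_·_ : ∀ {m n} → Matrix m n → 𝔽₂^ n → 𝔽₂^ m
W · x = tabulate λ i → ∑ λ j → W i j ℙ.* lookup x j

weight : ∀ {n} → 𝔽₂^ n → ℕ
weight = count (_≟ 1ℙ)

IsWiring : ∀ {n} → Matrix n n → Set
IsWiring W = ∀ i → W i i ≡ 1ℙ

degree : ∀ {n} → Matrix n n → Fin n → ℕ
degree W j = weight (tabulate λ i → W i j)

deg : ∀ {n} → Matrix n n → ℕ
deg W = Vector.foldr _⊔_ 0 (degree W)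

max : ∀ {n} → (𝔽₂^ n → ℕ) → ℕ
max {zero}  f = f []
max {suc n} f = max (λ x → f (0ℙ ∷ x)) ⊔ max (λ x → f (1ℙ ∷ x))

M : ∀ {n} → Matrix n n → 𝔽₂^ n → ℕ
M W c = max λ x → weight (W · x ⊕ c)

A : (n m : ℕ) → Matrix n n → Set
A n m W = IsWiring W × deg W ≤ m

A* : (n m : ℕ) → Matrix n n → Set
A* n m W = IsWiring W × (∀ j → degree W j ≡ m)

-- The minima are given by their graphs: μ[ n , m ]≡ k says that the minimum
-- of { M(W,0) : W ∈ A(n,m) } exists and equals k.  A minimum is unique, so
-- at most one k qualifies.
μ[_,_]≡_ : ℕ → ℕ → ℕ → Set
μ[ n , m ]≡ k = IsLeast (λ l → ∃[ W ] A n m W × M W 𝟎 ≡ l) k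

μ*[_,_]≡_ : ℕ → ℕ → ℕ → Set
μ*[ n , m ]≡ k = IsLeast (λ l → ∃[ W ] A* n m W × M W 𝟎 ≡ l) k

max-upper : ∀ {n} (f : 𝔽₂^ n → ℕ) x → f x ≤ max f
max-upper f []       = ≤-refl
max-upper f (0ℙ ∷ x) = ≤-trans (max-upper (λ y → f (0ℙ ∷ y)) x) (m≤m⊔n _ _)
max-upper f (1ℙ ∷ x) = ≤-trans (max-upper (λ y → f (1ℙ ∷ y)) x) (m≤n⊔m _ _)

max-attained : ∀ {n} (f : 𝔽₂^ n → ℕ) → ∃[ x ] f x ≡ max f
max-attained {zero}  f = [] , refl
max-attained {suc n} f
  with max-attained (λ y → f (0ℙ ∷ y)) | max-attained (λ y → f (1ℙ ∷ y))
     | ⊔-sel (max λ y → f (0ℙ ∷ y)) (max λ y → f (1ℙ ∷ y))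
... | x , p | _     | inj₁ q rewrite q = 0ℙ ∷ x , p
... | _     | x , p | inj₂ q rewrite q = 1ℙ ∷ x , p

M-isGreatest : ∀ {n} (W : Matrix n n) c → IsGreatest (λ l → ∃[ x ] weight (W · x ⊕ c) ≡ l) (M W c)
M-isGreatest W c = max-attained _ , λ { _ (x , refl) → max-upper _ x }

{-# OPTIONS --safe #-}

-- Lower bound.  View W as its list of rows: every row is nonzero and every
-- column has at most two 1s, and both properties survive the deletion of rows.
-- Delete a few rows, solve the rest by induction, and then correct the solution
-- with columns that vanish on the remaining rows:
--   * a row owning a private column can be lit: 1 row, gain 1;
--   * two equal rows sharing a column can be lit together: 2 rows, gain 2;
--   * otherwise some rows r, s, t have columns {r,s} and {r,t}, with which at
--     least two of the three can be lit: 3 rows, gain 2.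
-- If all columns have weight exactly 2, then W x has even weight.
-- Upper bound.  Direct sums of 3-cycles (each lights at most two bulbs) and at
-- most two all-ones blocks of size at most 2.
module Submission where

open import Defs
open import Algebra.Properties.CommutativeSemigroup using (x∙yz≈y∙xz)
open import Algebra.Properties.CommutativeMonoid.Sum using (∑-comm)
open import Algebra.Properties.Monoid.Sum using (sum-cong-≗; sum-replicate-zero)
open import Algebra.Properties.Semiring.Sum using (*-distribʳ-sum)
open import Data.Fin.Base using (Fin; zero; suc; _↑ˡ_; _↑ʳ_; splitAt)
open import Data.Fin.Properties using (any?; splitAt-↑ˡ; splitAt-↑ʳ)
open import Data.Integer.Base as ℤ using ()
open import Data.Integer.DivMod as ℤ using (a≡a%n+[a/n]*n; n%d<d)
open import Data.Integer.Properties as ℤ using (abs-*; ∣-i∣≡∣i∣)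
open import Data.List.Base as List using (List; []; _∷_; length; map)
open import Data.List.Properties using (length-++; length-tabulate; map-++)
open import Data.List.Relation.Binary.Permutation.Propositional using (_↭_; prep; swap; ↭-refl; ↭-sym; ↭-trans)
open import Data.List.Relation.Binary.Permutation.Propositional.Properties using (↭-length; map⁺; All-resp-↭)
open import Data.List.Relation.Unary.All as All using (All; []; _∷_)
open import Data.List.Relation.Unary.All.Properties using (¬Any⇒All¬; tabulate⁺)
open import Data.List.Relation.Unary.Any as Any using (Any; here; there)
open import Data.Nat.Base using (ℕ; zero; suc; _+_; _*_; _≤_; _<_; _⊔_; z≤n; s≤s; parity)
open import Data.Nat.Divisibility using (_∣_; divides; m∣m*n; ∣m∣n⇒∣m+n; ∣-refl; _∣0)
open import Data.Nat.ListAction using (sum)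
open import Data.Nat.ListAction.Properties using (sum-++; sum-↭)
open import Data.Nat.Properties hiding (_≟_)
open import Data.Parity.Base as ℙ using (0ℙ; 1ℙ; _⁻¹)
open import Data.Parity.Properties as ℙ using (_≟_; ⁻¹-involutive; suc-homo-⁻¹)
open import Data.Product.Base using (_×_; _,_; ∃-syntax)
open import Data.Sum.Base using ([_,_])
open import Data.Vec.Base as Vec using ([]; _∷_; lookup; tabulate; updateAt; _++_)
open import Data.Vec.Functional as Vector using ()
open import Data.Vec.Properties using (zipWith-identityʳ; tabulate-cong; lookup-++ˡ; lookup-++ʳ)
open import Function.Base using (_∘_; _$_; const)
open import Relation.Binary.PropositionalEquality using (_≡_; _≢_; _≗_; refl; sym; trans; cong; cong₂; subst; subst₂; module ≡-Reasoning)
open import Relation.Nullary using (¬_; yes; no; contradiction)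
open import Relation.Nullary.Decidable using (¬?; decidable-stable)

-- Ceilings

-- The ceiling is minus the floor of `-a / suc d`. Dividing `-a` with remainder `r` gives
-- `q * D = -(a + r)`, and taking absolute values clears the signs.
⌈/⌉-remainder : ∀ a d → ∃[ r ] r < suc d × ⌈ a / suc d ⌉ * suc d ≡ a + r
⌈/⌉-remainder a d = r , n%d<d z D , eq
  where
  z = ℤ.- (ℤ.+ a)
  D = ℤ.+ suc d
  q = z ℤ./ D
  r = z ℤ.% D

  qD≡ : q ℤ.* D ≡ ℤ.- (ℤ.+ (a + r))
  qD≡ = begin
    q ℤ.* D                              ≡⟨ ℤ.+-identityˡ _ ⟨
    ℤ.0ℤ ℤ.+ q ℤ.* D                     ≡⟨ cong (ℤ._+ q ℤ.* D) (ℤ.+-inverseˡ (ℤ.+ r)) ⟨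
    ℤ.- (ℤ.+ r) ℤ.+ ℤ.+ r ℤ.+ q ℤ.* D        ≡⟨ ℤ.+-assoc (ℤ.- (ℤ.+ r)) (ℤ.+ r) _ ⟩
    ℤ.- (ℤ.+ r) ℤ.+ (ℤ.+ r ℤ.+ q ℤ.* D)      ≡⟨ cong (λ i → ℤ.- (ℤ.+ r) ℤ.+ i) (a≡a%n+[a/n]*n z D) ⟨
    ℤ.- (ℤ.+ r) ℤ.+ z                      ≡⟨ ℤ.+-comm (ℤ.- (ℤ.+ r)) z ⟩
    z ℤ.+ ℤ.- (ℤ.+ r)                      ≡⟨ ℤ.neg-distrib-+ (ℤ.+ a) (ℤ.+ r) ⟨
    ℤ.- (ℤ.+ (a + r))                      ∎
    where open ≡-Reasoning

  eq : ℤ.∣ ℤ.- q ∣ * suc d ≡ a + r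
  eq = begin
    ℤ.∣ ℤ.- q ∣ * suc d   ≡⟨ cong (_* suc d) (∣-i∣≡∣i∣ q) ⟩
    ℤ.∣ q ∣ * suc d       ≡⟨ abs-* q D ⟨
    ℤ.∣ q ℤ.* D ∣         ≡⟨ cong ℤ.∣_∣ qD≡ ⟩
    ℤ.∣ ℤ.- (ℤ.+ (a + r)) ∣ ≡⟨ ∣-i∣≡∣i∣ (ℤ.+ (a + r)) ⟩
    a + r                 ∎
    where open ≡-Reasoning

a≤d*⌈a/d⌉ : ∀ a d → a ≤ suc d * ⌈ a / suc d ⌉
a≤d*⌈a/d⌉ a d with r , _ , eq ← ⌈/⌉-remainder a d =
  subst (a ≤_) (trans (sym eq) (*-comm ⌈ a / suc d ⌉ (suc d))) (m≤m+n a r)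

-- Since `r < suc d`, the multiple `a + r` of `suc d` lies strictly below `suc d * suc c`.
⌈a/d⌉≤ : ∀ a d c → a ≤ suc d * c → ⌈ a / suc d ⌉ ≤ c
⌈a/d⌉≤ a d c a≤dc with r , r<d , eq ← ⌈/⌉-remainder a d =
  m<1+n⇒m≤n (*-cancelʳ-< (suc d) ⌈ a / suc d ⌉ (suc c) (begin-strict
    ⌈ a / suc d ⌉ * suc d ≡⟨ eq ⟩
    a + r                 <⟨ +-mono-≤-< a≤dc r<d ⟩
    suc d * c + suc d     ≡⟨ +-comm (suc d * c) (suc d) ⟩
    suc d + suc d * c     ≡⟨ cong (suc d +_) (*-comm (suc d) c) ⟩
    suc c * suc d         ∎))
  where open ≤-Reasoning

-- The slack `d` falls one short of a full `suc d`, so `c` stays strictly below the successor of the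
-- ceiling.
≤⌈a/d⌉ : ∀ a d c → suc d * c ≤ a + d → c ≤ ⌈ a / suc d ⌉
≤⌈a/d⌉ a d c dc≤a+d = m<1+n⇒m≤n (*-cancelˡ-< (suc d) c (suc ⌈ a / suc d ⌉) (begin-strict
    suc d * c                     ≤⟨ dc≤a+d ⟩
    a + d                         <⟨ +-mono-≤-< (a≤d*⌈a/d⌉ a d) (n<1+n d) ⟩
    suc d * ⌈ a / suc d ⌉ + suc d ≡⟨ +-comm (suc d * ⌈ a / suc d ⌉) (suc d) ⟩
    suc d + suc d * ⌈ a / suc d ⌉ ≡⟨ *-suc (suc d) ⌈ a / suc d ⌉ ⟨
    suc d * suc ⌈ a / suc d ⌉     ∎))
  where open ≤-Reasoning

-- Sums and weights over 𝔽₂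

bit : 𝔽₂ → ℕ
bit 0ℙ = 0
bit 1ℙ = 1

weight-∷ : ∀ {n} p (v : 𝔽₂^ n) → weight (p ∷ v) ≡ bit p + weight v
weight-∷ 0ℙ v = refl
weight-∷ 1ℙ v = refl

parity-suc : ∀ n → parity (suc n) ≡ parity n ⁻¹
parity-suc n = trans (sym (⁻¹-involutive _)) (cong _⁻¹ (suc-homo-⁻¹ n))

parity-weight : ∀ {n} (f : Fin n → 𝔽₂) → parity (weight (tabulate f)) ≡ ∑ f
parity-weight {zero}  f = refl
parity-weight {suc n} f with f zero
... | 0ℙ = parity-weight (f ∘ suc)
... | 1ℙ = trans (parity-suc (weight (tabulate (f ∘ suc)))) (cong _⁻¹ (parity-weight (f ∘ suc)))

parity≡0⇒2∣ : ∀ n → parity n ≡ 0ℙ → 2 ∣ n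
parity≡0⇒2∣ zero          _ = 2 ∣0
parity≡0⇒2∣ (suc (suc n)) p = ∣m∣n⇒∣m+n ∣-refl (parity≡0⇒2∣ n p)

weight-⊕𝟎 : ∀ {n} (v : 𝔽₂^ n) → weight (v ⊕ 𝟎) ≡ weight v
weight-⊕𝟎 v = cong weight (zipWith-identityʳ ℙ.+-identityʳ v)

∑-cong : ∀ {n} {f g : Fin n → 𝔽₂} → f ≗ g → ∑ f ≡ ∑ g
∑-cong = sum-cong-≗ ℙ.+-0-monoid

∑-zero : ∀ n {f : Fin n → 𝔽₂} → (∀ i → f i ≡ 0ℙ) → ∑ f ≡ 0ℙ
∑-zero n f≡0 = trans (∑-cong f≡0) (sum-replicate-zero ℙ.+-0-monoid n)

∑-split : ∀ k {n} (f : Fin (k + n) → 𝔽₂) → ∑ f ≡ ∑ (λ i → f (i ↑ˡ n)) ℙ.+ ∑ (λ i → f (k ↑ʳ i))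
∑-split zero    f = refl
∑-split (suc k) f = trans (cong (f zero ℙ.+_) (∑-split k (f ∘ suc))) (sym (ℙ.+-assoc (f zero) _ _))

weight-split : ∀ k {n} (f : Fin (k + n) → 𝔽₂) →
  weight (tabulate f) ≡ weight (tabulate λ i → f (i ↑ˡ n)) + weight (tabulate λ i → f (k ↑ʳ i))
weight-split zero    f = refl
weight-split (suc k) {n} f = begin
  weight (tabulate f)                               ≡⟨ weight-∷ (f zero) (tabulate (f ∘ suc)) ⟩
  bit (f zero) + weight (tabulate (f ∘ suc))        ≡⟨ cong (bit (f zero) +_) (weight-split k (f ∘ suc)) ⟩
  bit (f zero) + (weight l + weight r)              ≡⟨ +-assoc (bit (f zero)) _ _ ⟨
  bit (f zero) + weight l + weight r                ≡⟨ cong (_+ weight r) (weight-∷ (f zero) l) ⟨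
  weight (f zero ∷ l) + weight r                    ∎
  where
  open ≡-Reasoning
  l = tabulate λ i → f (suc (i ↑ˡ n))
  r = tabulate λ i → f (suc (k ↑ʳ i))

weight-zero : ∀ {n} {f : Fin n → 𝔽₂} → (∀ i → f i ≡ 0ℙ) → weight (tabulate f) ≡ 0
weight-zero {zero}  f≡0 = refl
weight-zero {suc n} f≡0 rewrite f≡0 zero = weight-zero (f≡0 ∘ suc)

-- Rows and the parity of outputs

Row : ℕ → Set
Row m = Fin m → 𝔽₂

⟨_,_⟩ : ∀ {m} → Row m → 𝔽₂^ m → 𝔽₂
⟨ r , x ⟩ = ∑ λ j → r j ℙ.* lookup x j

-- Modulo 2 the weight is the sum of all entries of `W · x`. Exchanging the two sums turns it into a
-- sum of column parities, each of which vanishes.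
columns-even⇒weight-even : ∀ {m n} (W : Matrix m n) →
  (∀ j → parity (weight (tabulate λ i → W i j)) ≡ 0ℙ) → ∀ x → parity (weight (W · x)) ≡ 0ℙ
columns-even⇒weight-even {m} {n} W even x = begin
  parity (weight (W · x))                 ≡⟨ parity-weight (λ i → ⟨ W i , x ⟩) ⟩
  ∑ (λ i → ∑ λ j → W i j ℙ.* lookup x j)  ≡⟨ ∑-comm ℙ.+-0-commutativeMonoid (λ i j → W i j ℙ.* lookup x j) ⟩
  ∑ (λ j → ∑ λ i → W i j ℙ.* lookup x j)  ≡⟨ ∑-zero n column ⟩
  0ℙ                                      ∎
  where
  open ≡-Reasoning
  column : ∀ j → ∑ (λ i → W i j ℙ.* lookup x j) ≡ 0ℙ
  column j = begin
    ∑ (λ i → W i j ℙ.* lookup x j)  ≡⟨ *-distribʳ-sum ℙ.+-*-semiring (lookup x j) (λ i → W i j) ⟨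
    ∑ (λ i → W i j) ℙ.* lookup x j  ≡⟨ cong (ℙ._* lookup x j) (trans (sym (parity-weight λ i → W i j)) (even j)) ⟩
    0ℙ                              ∎

-- The lower bound

press : ∀ {m} → Fin m → 𝔽₂^ m → 𝔽₂^ m
press j x = updateAt x j _⁻¹

-- `press j` adds the unit vector at `j` to `x`, and the pairing is linear in `x`.
⟨⟩-press : ∀ {m} (r : Row m) j x → ⟨ r , press j x ⟩ ≡ r j ℙ.+ ⟨ r , x ⟩
⟨⟩-press r zero (a ∷ x) = lemma (r zero) a
  where
  lemma : ∀ p q {s} → p ℙ.* q ⁻¹ ℙ.+ s ≡ p ℙ.+ (p ℙ.* q ℙ.+ s)
  lemma 0ℙ q      = refl
  lemma 1ℙ 0ℙ     = refl
  lemma 1ℙ 1ℙ {s} = sym (⁻¹-involutive s)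
⟨⟩-press r (suc j) (a ∷ x) =
  trans (cong (r zero ℙ.* a ℙ.+_) (⟨⟩-press (r ∘ suc) j x))
        (x∙yz≈y∙xz ℙ.+-commutativeSemigroup (r zero ℙ.* a) (r (suc j)) ⟨ r ∘ suc , x ⟩)

module _ {m : ℕ} where

  press-on : ∀ (r : Row m) {j} x {p} → r j ≡ 1ℙ → ⟨ r , x ⟩ ≡ p → ⟨ r , press j x ⟩ ≡ p ⁻¹
  press-on r {j} x rj≡1 eq = trans (⟨⟩-press r j x) (cong₂ ℙ._+_ rj≡1 eq)

  press-off : ∀ (r : Row m) {j} x {p} → r j ≡ 0ℙ → ⟨ r , x ⟩ ≡ p → ⟨ r , press j x ⟩ ≡ p
  press-off r {j} x rj≡0 eq = trans (⟨⟩-press r j x) (cong₂ ℙ._+_ rj≡0 eq)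

  -- Counting over lists of rows

  count : (Row m → 𝔽₂) → List (Row m) → ℕ
  count f rs = sum (map (bit ∘ f) rs)

  count-↭ : ∀ f {rs rs′} → rs ↭ rs′ → count f rs ≡ count f rs′
  count-↭ f rs↭ = sum-↭ (map⁺ (bit ∘ f) rs↭)

  count-++ : ∀ f rs rs′ → count f (rs List.++ rs′) ≡ count f rs + count f rs′
  count-++ f rs rs′ = trans (cong sum (map-++ (bit ∘ f) rs rs′)) (sum-++ (map (bit ∘ f) rs) _)

  count≡0⇒All : ∀ f rs → count f rs ≤ 0 → All (λ r → f r ≡ 0ℙ) rs
  count≡0⇒All f []       _ = []
  count≡0⇒All f (r ∷ rs) p with f r in eq
  ... | 0ℙ = eq ∷ count≡0⇒All f rs p

  lit : 𝔽₂^ m → List (Row m) → ℕ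
  lit x = count ⟨_, x ⟩

  Silent : Fin m → List (Row m) → Set
  Silent j = All λ r → r j ≡ 0ℙ

  lit-press : ∀ {j rs} x → Silent j rs → lit (press j x) rs ≡ lit x rs
  lit-press x []                  = refl
  lit-press x (_∷_ {r} rj≡0 rest) = cong₂ _+_ (cong bit (press-off r x rj≡0 refl)) (lit-press x rest)

  ¬Any⇒Silent : ∀ {j rs} → ¬ Any (λ r → r j ≡ 1ℙ) rs → Silent j rs
  ¬Any⇒Silent ¬any = All.map ≢1⇒≡0 (¬Any⇒All¬ _ ¬any)
    where
    ≢1⇒≡0 : ∀ {p} → p ≢ 1ℙ → p ≡ 0ℙ
    ≢1⇒≡0 {0ℙ} _   = refl
    ≢1⇒≡0 {1ℙ} 1≢1 = contradiction refl 1≢1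

  -- A row found by search is moved to the front. Admissibility and the two-thirds bound are
  -- invariant under this reordering.
  extract : ∀ {P : Row m → Set} {rs} → Any P rs → ∃[ r ] ∃[ rs′ ] P r × rs ↭ r ∷ rs′
  extract (here pr) = _ , _ , pr , ↭-refl
  extract (there {r′} any) with r , rs′ , pr , rs↭ ← extract any =
    r , r′ ∷ rs′ , pr , ↭-trans (prep r′ rs↭) (swap r′ r ↭-refl)

  -- What a wiring of degree at most 2 retains when rows are deleted while all columns are kept: the
  -- diagonal loses its meaning, but each row still has a 1.
  record Admissible (rs : List (Row m)) : Set where
    field
      columns : ∀ j → count (_$ j) rs ≤ 2
      nonzero : All (λ r → ∃[ j ] r j ≡ 1ℙ) rs
  open Admissible

  admissible-tail : ∀ {r rs} → Admissible (r ∷ rs) → Admissible rs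
  admissible-tail {r} ad = record
    { columns = λ j → ≤-trans (m≤n+m _ (bit (r j))) (columns ad j)
    ; nonzero = All.tail (nonzero ad)
    }

  admissible-↭ : ∀ {rs rs′} → rs ↭ rs′ → Admissible rs → Admissible rs′
  admissible-↭ rs↭ ad = record
    { columns = λ j → subst (_≤ 2) (count-↭ (_$ j) rs↭) (columns ad j)
    ; nonzero = All-resp-↭ rs↭ (nonzero ad)
    }

  full-column : ∀ {r s rs j} → Admissible (r ∷ s ∷ rs) → r j ≡ 1ℙ → s j ≡ 1ℙ → Silent j rs
  full-column {r} {s} {rs} {j} ad rj≡1 sj≡1 with c ← columns ad j rewrite rj≡1 | sj≡1 =
    count≡0⇒All (_$ j) rs (+-cancelˡ-≤ 2 _ _ c)

  -- The two-thirds bound and its three gains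

  TwoThirds : List (Row m) → Set
  TwoThirds rs = ∃[ x ] 2 * length rs ≤ 3 * lit x rs

  twoThirds-↭ : ∀ {rs rs′} → rs ↭ rs′ → TwoThirds rs → TwoThirds rs′
  twoThirds-↭ rs↭ (x , p) =
    x , subst₂ (λ a b → 2 * a ≤ 3 * b) (↭-length rs↭) (count-↭ ⟨_, x ⟩ rs↭) p

  -- Cleared of denominators, the bound is additive over concatenation. Here `x` solves `rs`, and
  -- the correction `y` keeps the count there while serving `new`.
  adjoin : ∀ new rs x y → 2 * length rs ≤ 3 * lit x rs → lit y rs ≡ lit x rs →
    2 * length new ≤ 3 * lit y new → TwoThirds (new List.++ rs)
  adjoin new rs x y old same gain = y , (begin
    2 * length (new List.++ rs)     ≡⟨ cong (2 *_) (length-++ new) ⟩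
    2 * (length new + length rs)    ≡⟨ *-distribˡ-+ 2 (length new) _ ⟩
    2 * length new + 2 * length rs  ≤⟨ +-mono-≤ gain old ⟩
    3 * lit y new + 3 * lit x rs    ≡⟨ cong (λ w → 3 * lit y new + 3 * w) same ⟨
    3 * lit y new + 3 * lit y rs    ≡⟨ *-distribˡ-+ 3 (lit y new) _ ⟨
    3 * (lit y new + lit y rs)      ≡⟨ cong (3 *_) (count-++ ⟨_, y ⟩ new rs) ⟨
    3 * lit y (new List.++ rs)      ∎)
    where open ≤-Reasoning

  gain₁ : ∀ {r rs j} → r j ≡ 1ℙ → Silent j rs → TwoThirds rs → TwoThirds (r ∷ rs)
  gain₁ {r} {rs} {j} rj≡1 silent (x , p) = by-value ⟨ r , x ⟩ refl
    where
    finish : ∀ y → lit y rs ≡ lit x rs → ⟨ r , y ⟩ ≡ 1ℙ → TwoThirds (r ∷ rs)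
    finish y same ry≡1 = adjoin (r ∷ []) rs x y p same gain
      where
      gain : 2 ≤ 3 * lit y (r ∷ [])
      gain rewrite ry≡1 = n≤1+n 2

    by-value : ∀ a → ⟨ r , x ⟩ ≡ a → TwoThirds (r ∷ rs)
    by-value 1ℙ eq = finish x refl eq
    by-value 0ℙ eq = finish (press j x) (lit-press x silent) (press-on r x rj≡1 eq)

  -- Equal rows take the same value at every vector, so one press of `j` lights both if they are
  -- dark.
  gain₂ : ∀ {r s rs j} → r ≗ s → r j ≡ 1ℙ → Silent j rs → TwoThirds rs → TwoThirds (r ∷ s ∷ rs)
  gain₂ {r} {s} {rs} {j} r≗s rj≡1 silent (x , p) = by-value ⟨ r , x ⟩ refl
    where
    ⟨s⟩≡⟨r⟩ : ∀ y → ⟨ s , y ⟩ ≡ ⟨ r , y ⟩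
    ⟨s⟩≡⟨r⟩ y = ∑-cong λ k → cong (ℙ._* lookup y k) (sym (r≗s k))

    finish : ∀ y → lit y rs ≡ lit x rs → ⟨ r , y ⟩ ≡ 1ℙ → TwoThirds (r ∷ s ∷ rs)
    finish y same ry≡1 = adjoin (r ∷ s ∷ []) rs x y p same gain
      where
      gain : 4 ≤ 3 * lit y (r ∷ s ∷ [])
      gain rewrite ⟨s⟩≡⟨r⟩ y | ry≡1 = m≤m+n 4 2

    by-value : ∀ a → ⟨ r , x ⟩ ≡ a → TwoThirds (r ∷ s ∷ rs)
    by-value 1ℙ eq = finish x refl eq
    by-value 0ℙ eq = finish (press j x) (lit-press x silent) (press-on r x rj≡1 eq)

  -- Pressing `j` toggles `r` and `s`, pressing `k` toggles `r` and `t`. These generate all even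
  -- changes of the triple, and each parity class of triples contains one with at least two 1s.
  gain₃ : ∀ {r s t rs j k} →
    r j ≡ 1ℙ → s j ≡ 1ℙ → t j ≡ 0ℙ → Silent j rs →
    r k ≡ 1ℙ → s k ≡ 0ℙ → t k ≡ 1ℙ → Silent k rs →
    TwoThirds rs → TwoThirds (r ∷ s ∷ t ∷ rs)
  gain₃ {r} {s} {t} {rs} {j} {k} rj sj tj silent-j rk sk tk silent-k (x , p) =
    by-values ⟨ r , x ⟩ ⟨ s , x ⟩ ⟨ t , x ⟩ refl refl refl
    where
    finish : ∀ a b c y → lit y rs ≡ lit x rs → ⟨ r , y ⟩ ≡ a → ⟨ s , y ⟩ ≡ b → ⟨ t , y ⟩ ≡ c →
      2 ≤ bit a + (bit b + (bit c + 0)) → TwoThirds (r ∷ s ∷ t ∷ rs)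
    finish a b c y same refl refl refl two = adjoin (r ∷ s ∷ t ∷ []) rs x y p same (*-monoʳ-≤ 3 two)

    xj = press j x
    xk = press k x

    by-values : ∀ a b c → ⟨ r , x ⟩ ≡ a → ⟨ s , x ⟩ ≡ b → ⟨ t , x ⟩ ≡ c → TwoThirds (r ∷ s ∷ t ∷ rs)
    by-values 1ℙ 1ℙ c ra sb tc = finish 1ℙ 1ℙ c x refl ra sb tc (s≤s (s≤s z≤n))
    by-values 1ℙ 0ℙ 1ℙ ra sb tc = finish 1ℙ 0ℙ 1ℙ x refl ra sb tc (s≤s (s≤s z≤n))
    by-values 0ℙ 1ℙ 1ℙ ra sb tc = finish 0ℙ 1ℙ 1ℙ x refl ra sb tc (s≤s (s≤s z≤n))
    by-values 0ℙ 0ℙ c ra sb tc = finish 1ℙ 1ℙ c xj (lit-press x silent-j)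
      (press-on r x rj ra) (press-on s x sj sb) (press-off t x tj tc) (s≤s (s≤s z≤n))
    by-values 0ℙ 1ℙ 0ℙ ra sb tc = finish 1ℙ 1ℙ 1ℙ xk (lit-press x silent-k)
      (press-on r x rk ra) (press-off s x sk sb) (press-on t x tk tc) (s≤s (s≤s z≤n))
    -- Both presses are made: `r` is toggled twice and stays lit, while `s` and `t` are lit once
    -- each.
    by-values 1ℙ 0ℙ 0ℙ ra sb tc = finish 1ℙ 1ℙ 1ℙ (press k xj)
      (trans (lit-press xj silent-k) (lit-press x silent-j))
      (press-on r xj rk (press-on r x rj ra))
      (press-off s xj sk (press-on s x sj sb))
      (press-on t xj tk (press-off t x tj tc)) (s≤s (s≤s z≤n))

  -- Induction on the number of rows

  Below : ℕ → Set
  Below n = ∀ rs → length rs ≤ n → Admissible rs → TwoThirds rs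

  -- If no row of `rs` meets column `k`, that column is private to `r`. Otherwise some `t` meets it,
  -- so column `j` is exhausted by `r` and `s`, column `k` by `r` and `t`, and `gain₃` applies.
  step-distinct : ∀ {n r s rs j k} → Below n → length (s ∷ rs) ≤ n → Admissible (r ∷ s ∷ rs) →
    r j ≡ 1ℙ → s j ≡ 1ℙ → r k ≡ 1ℙ → s k ≡ 0ℙ → TwoThirds (r ∷ s ∷ rs)
  step-distinct {n} {r} {s} {rs} {j} {k} below len ad rj sj rk sk with Any.any? (λ t → t k ≟ 1ℙ) rs
  ... | no ¬any = gain₁ rk (sk ∷ ¬Any⇒Silent ¬any) (below (s ∷ rs) len (admissible-tail ad))
  ... | yes any with t , rs′ , tk , rs↭ ← extract any =
    twoThirds-↭ (↭-sym perm)
      (gain₃ rj sj (All.head silent-j) (All.tail silent-j) rk sk tk (All.tail silent-k) rest)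
    where
    perm : r ∷ s ∷ rs ↭ r ∷ s ∷ t ∷ rs′
    perm = prep r (prep s rs↭)

    ad′ : Admissible (r ∷ s ∷ t ∷ rs′)
    ad′ = admissible-↭ perm ad

    silent-j : Silent j (t ∷ rs′)
    silent-j = full-column ad′ rj sj

    silent-k : Silent k (s ∷ rs′)
    -- Moving `t` ahead of `s` puts the two rows that fill column `k` in front.
    silent-k = full-column (admissible-↭ (prep r (swap s t ↭-refl)) ad′) rk tk

    rest : TwoThirds rs′
    rest = below rs′ (≤-trans (m≤n+m _ 2) (subst (λ l → suc l ≤ n) (↭-length rs↭) len))
      (admissible-tail (admissible-tail (admissible-tail ad′)))

  step-pair : ∀ {n r s rs j} → Below n → length (s ∷ rs) ≤ n → Admissible (r ∷ s ∷ rs) →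
    r j ≡ 1ℙ → s j ≡ 1ℙ → TwoThirds (r ∷ s ∷ rs)
  step-pair {n} {r} {s} {rs} below len ad rj sj with any? (λ k → ¬? (r k ≟ s k))
  ... | no none = gain₂ (λ k → decidable-stable (r k ≟ s k) λ ne → none (k , ne)) rj (full-column ad rj sj)
    (below rs (≤-trans (n≤1+n _) len) (admissible-tail (admissible-tail ad)))
  ... | yes (k , rk≢sk) with r k in rk | s k in sk
  ...   | 0ℙ | 0ℙ = contradiction refl rk≢sk
  ...   | 1ℙ | 1ℙ = contradiction refl rk≢sk
  ...   | 1ℙ | 0ℙ = step-distinct below len ad rj sj rk sk
  -- The 1 in the distinguishing column belongs to `s`, so the two rows exchange roles.
  ...   | 0ℙ | 1ℙ = twoThirds-↭ {s ∷ r ∷ rs} (swap s r ↭-refl)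
    (step-distinct below len (admissible-↭ (swap r s ↭-refl) ad) sj rj sk rk)

  -- The recursion runs on a length bound because the remaining rows come from a permutation and
  -- need not be a structural sublist. A 1 of the first row selects a column, which is either
  -- private or shared with one other row.
  admissible⇒twoThirds : ∀ n → Below n
  admissible⇒twoThirds n       []       _         _  = Vec.replicate m 0ℙ , z≤n
  admissible⇒twoThirds (suc n) (r ∷ rs) (s≤s len) ad with All.head (nonzero ad)
  ... | j , rj with Any.any? (λ s → s j ≟ 1ℙ) rs
  ...   | no ¬any = gain₁ rj (¬Any⇒Silent ¬any) (admissible⇒twoThirds n rs len (admissible-tail ad))
  ...   | yes any with s , rs′ , sj , rs↭ ← extract any =
    twoThirds-↭ (↭-sym (prep r rs↭))
      (step-pair (admissible⇒twoThirds n) (subst (_≤ n) (↭-length rs↭) len)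
        (admissible-↭ (prep r rs↭) ad) rj sj)

  -- From lists of rows back to wirings

  count-tabulate : ∀ f {n} (W : Matrix n m) → count f (List.tabulate W) ≡ weight (tabulate (f ∘ W))
  count-tabulate f {zero}  W = refl
  count-tabulate f {suc n} W =
    trans (cong (λ w → bit (f (W zero)) + w) (count-tabulate f (W ∘ suc))) (sym (weight-∷ (f (W zero)) (tabulate (f ∘ W ∘ suc))))

weight≤M : ∀ {n} (W : Matrix n n) x → weight (W · x) ≤ M W 𝟎
weight≤M W x = subst (_≤ M W 𝟎) (weight-⊕𝟎 (W · x)) (max-upper _ x)

M-attained : ∀ {n} (W : Matrix n n) → ∃[ x ] weight (W · x) ≡ M W 𝟎
M-attained W with x , eq ← max-attained (λ x → weight (W · x ⊕ 𝟎)) =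
  x , trans (sym (weight-⊕𝟎 (W · x))) eq

M-lower : ∀ {n} (W : Matrix n n) → IsWiring W → (∀ j → degree W j ≤ 2) → 2 * n ≤ 3 * M W 𝟎
M-lower {n} W wiring degrees
  with x , p ← admissible⇒twoThirds _ (List.tabulate W) ≤-refl (record
    { columns = λ j → subst (_≤ 2) (sym (count-tabulate (_$ j) W)) (degrees j)
    -- The diagonal entry is the 1 required in each row.
    ; nonzero = tabulate⁺ λ i → i , wiring i
    }) = begin
  2 * n                             ≡⟨ cong (2 *_) (length-tabulate W) ⟨
  2 * length (List.tabulate W)      ≤⟨ p ⟩
  3 * lit x (List.tabulate W)       ≡⟨ cong (3 *_) (count-tabulate ⟨_, x ⟩ W) ⟩
  3 * weight (W · x)                ≤⟨ *-monoʳ-≤ 3 (weight≤M W x) ⟩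
  3 * M W 𝟎                         ∎
  where open ≤-Reasoning

-- The maximum is itself the weight of some `W · x`, and all those weights are even.
M-even : ∀ {n} (W : Matrix n n) → (∀ j → degree W j ≡ 2) → 2 ∣ M W 𝟎
M-even W degrees with x , eq ← M-attained W =
  subst (2 ∣_) eq (parity≡0⇒2∣ _ (columns-even⇒weight-even W (λ j → cong parity (degrees j)) x))

degree≤deg : ∀ {n} (W : Matrix n n) j → degree W j ≤ deg W
degree≤deg W = go (degree W)
  where
  go : ∀ {n} (f : Fin n → ℕ) j → f j ≤ Vector.foldr _⊔_ 0 f
  go f zero    = m≤m⊔n (f zero) _
  go f (suc j) = ≤-trans (go (f ∘ suc) j) (m≤n⊔m (f zero) _)

deg≤ : ∀ {n} (W : Matrix n n) {d} → (∀ j → degree W j ≤ d) → deg W ≤ d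
deg≤ W {d} = go (degree W)
  where
  go : ∀ {n} (f : Fin n → ℕ) → (∀ j → f j ≤ d) → Vector.foldr _⊔_ 0 f ≤ d
  go {zero}  f _ = z≤n
  go {suc n} f p = ⊔-lub (p zero) (go (f ∘ suc) (p ∘ suc))

-- Direct sums and the extremal wirings

_⊞_ : ∀ {k n} → Matrix k k → Matrix n n → Matrix (k + n) (k + n)
_⊞_ {k} B W i j =
  [ (λ i′ → [ B i′ , const 0ℙ ] (splitAt k j))
  , (λ i′ → [ const 0ℙ , W i′ ] (splitAt k j)) ] (splitAt k i)

↑-elim : ∀ k {n} (P : Fin (k + n) → Set) → (∀ i → P (i ↑ˡ n)) → (∀ i → P (k ↑ʳ i)) → ∀ i → P i
↑-elim zero    P l r i       = r i
↑-elim (suc k) P l r zero    = l zero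
↑-elim (suc k) P l r (suc i) = ↑-elim k (P ∘ suc) (l ∘ suc) r i

module _ {k n} (B : Matrix k k) (W : Matrix n n) where

  ⊞-ˡˡ : ∀ i j → (B ⊞ W) (i ↑ˡ n) (j ↑ˡ n) ≡ B i j
  ⊞-ˡˡ i j rewrite splitAt-↑ˡ k i n | splitAt-↑ˡ k j n = refl

  ⊞-ˡʳ : ∀ i j → (B ⊞ W) (i ↑ˡ n) (k ↑ʳ j) ≡ 0ℙ
  ⊞-ˡʳ i j rewrite splitAt-↑ˡ k i n | splitAt-↑ʳ k n j = refl

  ⊞-ʳˡ : ∀ i j → (B ⊞ W) (k ↑ʳ i) (j ↑ˡ n) ≡ 0ℙ
  ⊞-ʳˡ i j rewrite splitAt-↑ʳ k n i | splitAt-↑ˡ k j n = refl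

  ⊞-ʳʳ : ∀ i j → (B ⊞ W) (k ↑ʳ i) (k ↑ʳ j) ≡ W i j
  ⊞-ʳʳ i j rewrite splitAt-↑ʳ k n i | splitAt-↑ʳ k n j = refl

  ⊞-wiring : IsWiring B → IsWiring W → IsWiring (B ⊞ W)
  ⊞-wiring b w = ↑-elim k _ (λ i → trans (⊞-ˡˡ i i) (b i)) (λ i → trans (⊞-ʳʳ i i) (w i))

  ⊞-degreeˡ : ∀ j → degree (B ⊞ W) (j ↑ˡ n) ≡ degree B j
  ⊞-degreeˡ j = begin
    degree (B ⊞ W) (j ↑ˡ n) ≡⟨ weight-split k _ ⟩
    _                       ≡⟨ cong₂ _+_ (cong weight (tabulate-cong λ i → ⊞-ˡˡ i j)) (weight-zero λ i → ⊞-ʳˡ i j) ⟩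
    degree B j + 0          ≡⟨ +-identityʳ _ ⟩
    degree B j              ∎
    where open ≡-Reasoning

  ⊞-degreeʳ : ∀ j → degree (B ⊞ W) (k ↑ʳ j) ≡ degree W j
  ⊞-degreeʳ j = trans (weight-split k _)
    (cong₂ _+_ (weight-zero λ i → ⊞-ˡʳ i j) (cong weight (tabulate-cong λ i → ⊞-ʳʳ i j)))

  ⊞-degrees : (P : ℕ → Set) → (∀ j → P (degree B j)) → (∀ j → P (degree W j)) → ∀ j → P (degree (B ⊞ W) j)
  ⊞-degrees P b w = ↑-elim k _
    (λ j → subst P (sym (⊞-degreeˡ j)) (b j)) (λ j → subst P (sym (⊞-degreeʳ j)) (w j))

  ⊞-rowˡ : ∀ i y z → ⟨ (B ⊞ W) (i ↑ˡ n) , y ++ z ⟩ ≡ ⟨ B i , y ⟩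
  ⊞-rowˡ i y z = begin
    ⟨ (B ⊞ W) (i ↑ˡ n) , y ++ z ⟩ ≡⟨ ∑-split k _ ⟩
    _ ≡⟨ cong₂ ℙ._+_ (∑-cong λ j → cong₂ ℙ._*_ (⊞-ˡˡ i j) (lookup-++ˡ y z j))
                     (∑-zero n λ j → cong (ℙ._* lookup (y ++ z) (k ↑ʳ j)) (⊞-ˡʳ i j)) ⟩
    ⟨ B i , y ⟩ ℙ.+ 0ℙ ≡⟨ ℙ.+-identityʳ _ ⟩
    ⟨ B i , y ⟩ ∎
    where open ≡-Reasoning

  ⊞-rowʳ : ∀ i y z → ⟨ (B ⊞ W) (k ↑ʳ i) , y ++ z ⟩ ≡ ⟨ W i , z ⟩
  ⊞-rowʳ i y z = trans (∑-split k _)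
    (cong₂ ℙ._+_ (∑-zero k λ j → cong (ℙ._* lookup (y ++ z) (j ↑ˡ n)) (⊞-ʳˡ i j))
                 (∑-cong λ j → cong₂ ℙ._*_ (⊞-ʳʳ i j) (lookup-++ʳ y z j)))

  ⊞-weight : ∀ y z → weight ((B ⊞ W) · (y ++ z)) ≡ weight (B · y) + weight (W · z)
  ⊞-weight y z = trans (weight-split k _)
    (cong₂ _+_ (cong weight (tabulate-cong λ i → ⊞-rowˡ i y z)) (cong weight (tabulate-cong λ i → ⊞-rowʳ i y z)))

  -- A maximiser for the direct sum splits into one vector per block, and the blocks do not
  -- interact.
  M-⊞ : M (B ⊞ W) 𝟎 ≤ M B 𝟎 + M W 𝟎
  M-⊞ with x , eq ← M-attained (B ⊞ W) with y , z , refl ← Vec.splitAt k x = begin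
    M (B ⊞ W) 𝟎                      ≡⟨ eq ⟨
    weight ((B ⊞ W) · (y ++ z))      ≡⟨ ⊞-weight y z ⟩
    weight (B · y) + weight (W · z)  ≤⟨ +-mono-≤ (weight≤M B y) (weight≤M W z) ⟩
    M B 𝟎 + M W 𝟎                    ∎
    where open ≤-Reasoning

-- Building blocks and extremal wirings

all-ones : ∀ n → Matrix n n
all-ones n _ _ = 1ℙ

-- The directed 3-cycle: each button toggles its own bulb and the next one cyclically. Every output
-- has even weight, hence at most 2.
triangle : Matrix 3 3
triangle zero             (suc zero)       = 0ℙ
triangle (suc zero)       (suc (suc zero)) = 0ℙ
triangle (suc (suc zero)) zero             = 0ℙ
triangle _                _                = 1ℙ

triangle-wiring : IsWiring triangle
triangle-wiring zero             = refl
triangle-wiring (suc zero)       = refl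
triangle-wiring (suc (suc zero)) = refl

triangle-degree : ∀ j → degree triangle j ≡ 2
triangle-degree zero             = refl
triangle-degree (suc zero)       = refl
triangle-degree (suc (suc zero)) = refl

all-ones-degree : ∀ n j → degree (all-ones n) j ≡ n
all-ones-degree n _ = go n
  where
  go : ∀ n → weight (tabulate {n = n} (const 1ℙ)) ≡ n
  go zero    = refl
  go (suc n) = cong suc (go n)

-- The slack 2 is exactly what `≤⌈a/d⌉` tolerates for the divisor 3; adding a triangle raises both
-- sides by 6 and preserves it.
Thrifty : ℕ → Set
Thrifty n = ∃[ W ] IsWiring {n} W × (∀ j → degree W j ≤ 2) × 3 * M W 𝟎 ≤ 2 * n + 2

all-ones-thrifty : ∀ n → n ≤ 2 → 3 * M (all-ones n) 𝟎 ≤ 2 * n + 2 → Thrifty n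
all-ones-thrifty n n≤2 bound =
  all-ones n , (λ _ → refl) , (λ j → subst (_≤ 2) (sym (all-ones-degree n j)) n≤2) , bound

thrifty : ∀ n → Thrifty n
thrifty 0 = all-ones-thrifty 0 z≤n z≤n
thrifty 1 = all-ones-thrifty 1 (s≤s z≤n) (n≤1+n 3)
thrifty 2 = all-ones-thrifty 2 ≤-refl ≤-refl
thrifty (suc (suc (suc n))) with W , wiring , degrees , bound ← thrifty n =
  triangle ⊞ W
  , ⊞-wiring triangle W triangle-wiring wiring
  , ⊞-degrees triangle W (_≤ 2) (λ j → ≤-reflexive (triangle-degree j)) degrees
  , (begin
    -- `M triangle 𝟎` evaluates to 2.
    3 * M (triangle ⊞ W) 𝟎 ≤⟨ *-monoʳ-≤ 3 (M-⊞ triangle W) ⟩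
    3 * (2 + M W 𝟎)        ≡⟨ *-distribˡ-+ 3 2 (M W 𝟎) ⟩
    6 + 3 * M W 𝟎          ≤⟨ +-monoʳ-≤ 6 bound ⟩
    6 + (2 * n + 2)        ≡⟨ +-assoc 6 (2 * n) 2 ⟨
    6 + 2 * n + 2          ≡⟨ cong (_+ 2) (*-distribˡ-+ 2 3 n) ⟨
    2 * (3 + n) + 2        ∎)
  where open ≤-Reasoning

-- The bound is stated through its half `h`, so that `3 * h ≤ n + 2` yields `h ≤ ⌈ n / 3 ⌉` and
-- doubling gives the even target.
Thrifty* : ℕ → Set
Thrifty* n = ∃[ W ] A* n 2 W × ∃[ h ] M W 𝟎 ≤ 2 * h × 3 * h ≤ n + 2

⊞-A* : ∀ {k n} (B : Matrix k k) (W : Matrix n n) → A* k 2 B → A* n 2 W → A* (k + n) 2 (B ⊞ W)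
⊞-A* B W (b , dB) (w , dW) = ⊞-wiring B W b w , ⊞-degrees B W (_≡ 2) dB dW

pair-A* : A* 2 2 (all-ones 2)
pair-A* = (λ _ → refl) , all-ones-degree 2

triangle-A* : A* 3 2 triangle
triangle-A* = triangle-wiring , triangle-degree

thrifty* : ∀ n → Thrifty* (2 + n)
-- The recursion by triangles starts at sizes 2, 3 and 4. Size 4 is two pairs, since a single vertex
-- cannot have degree 2.
thrifty* 0 = all-ones 2 , pair-A* , 1 , ≤-refl , n≤1+n 3
thrifty* 1 = triangle , triangle-A* , 1 , ≤-refl , m≤m+n 3 2
thrifty* 2 = all-ones 2 ⊞ all-ones 2 , ⊞-A* (all-ones 2) (all-ones 2) pair-A* pair-A* , 2 , M-⊞ (all-ones 2) (all-ones 2) , ≤-refl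
thrifty* (suc (suc (suc n))) with W , a , h , M≤2h , 3h≤ ← thrifty* n =
  triangle ⊞ W
  , ⊞-A* triangle W triangle-A* a
  , suc h
  , (begin
    M (triangle ⊞ W) 𝟎 ≤⟨ M-⊞ triangle W ⟩
    2 + M W 𝟎          ≤⟨ +-monoʳ-≤ 2 M≤2h ⟩
    2 + 2 * h          ≡⟨ *-suc 2 h ⟨
    2 * suc h          ∎)
  , subst (_≤ 3 + (2 + n + 2)) (sym (*-suc 3 h)) (+-monoʳ-≤ 3 3h≤)
  where open ≤-Reasoning

-- Values of the two minima

μ-value : ∀ n → μ[ n , 2 ]≡ ⌈ 2 * n / 3 ⌉
μ-value n = attained , λ { l (W , a , refl) → lower W a }
  where
  lower : ∀ W → A n 2 W → ⌈ 2 * n / 3 ⌉ ≤ M W 𝟎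
  lower W (wiring , deg≤2) =
    ⌈a/d⌉≤ (2 * n) 2 _ (M-lower W wiring λ j → ≤-trans (degree≤deg W j) deg≤2)

  attained : ∃[ W ] A n 2 W × M W 𝟎 ≡ ⌈ 2 * n / 3 ⌉
  attained with W , wiring , degrees , bound ← thrifty n =
    W , a , ≤-antisym (≤⌈a/d⌉ (2 * n) 2 _ bound) (lower W a)
    where
    a : A n 2 W
    a = wiring , deg≤ W degrees

-- With `e` equal to twice `h` the hypothesis halves to `n ≤ 3 * h`, so `h` is at least the ceiling.
-- This serves both the lower bound for `μ*` and the least even integer.
even≥2n/3 : ∀ n e → 2 ∣ e → 2 * n ≤ 3 * e → 2 * ⌈ n / 3 ⌉ ≤ e
even≥2n/3 n _ (divides h refl) 2n≤3e = subst (2 * ⌈ n / 3 ⌉ ≤_) (*-comm 2 h)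
  (*-monoʳ-≤ 2 (⌈a/d⌉≤ n 2 h (*-cancelˡ-≤ 2 (begin
    2 * n         ≤⟨ 2n≤3e ⟩
    3 * (h * 2)   ≡⟨ *-assoc 3 h 2 ⟨
    3 * h * 2     ≡⟨ *-comm (3 * h) 2 ⟩
    2 * (3 * h)   ∎))))
  where open ≤-Reasoning

μ*-value : ∀ n → 2 ≤ n → μ*[ n , 2 ]≡ (2 * ⌈ n / 3 ⌉)
μ*-value 1 (s≤s ())
μ*-value n@(suc (suc n′)) _ = attained , λ { l (W , a , refl) → lower W a }
  where
  lower : ∀ W → A* n 2 W → 2 * ⌈ n / 3 ⌉ ≤ M W 𝟎
  lower W (wiring , degrees) =
    even≥2n/3 n _ (M-even W degrees) (M-lower W wiring λ j → ≤-reflexive (degrees j))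

  attained : ∃[ W ] A* n 2 W × M W 𝟎 ≡ 2 * ⌈ n / 3 ⌉
  attained with W , a , h , M≤2h , 3h≤ ← thrifty* n′ =
    W , a , ≤-antisym (≤-trans M≤2h (*-monoʳ-≤ 2 (≤⌈a/d⌉ n 2 h 3h≤))) (lower W a)

-- This identifies any `k` given only as the minimum with the computed ceiling.
isLeast-unique : ∀ {S k l} → IsLeast S k → IsLeast S l → k ≡ l
isLeast-unique (sk , k≤) (sl , l≤) = ≤-antisym (k≤ _ sl) (l≤ _ sk)

least-even : ∀ n → IsLeast (λ e → 2 ∣ e × ⌈ 2 * n / 3 ⌉ ≤ e) (2 * ⌈ n / 3 ⌉)
least-even n = (m∣m*n ⌈ n / 3 ⌉ , ⌈a/d⌉≤ (2 * n) 2 (2 * ⌈ n / 3 ⌉) (begin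
    2 * n                 ≤⟨ *-monoʳ-≤ 2 (a≤d*⌈a/d⌉ n 2) ⟩
    2 * (3 * ⌈ n / 3 ⌉)   ≡⟨ *-assoc 2 3 ⌈ n / 3 ⌉ ⟨
    6 * ⌈ n / 3 ⌉         ≡⟨ *-assoc 3 2 ⌈ n / 3 ⌉ ⟩
    3 * (2 * ⌈ n / 3 ⌉)   ∎))
  , λ e (2∣e , ⌈2n/3⌉≤e) → even≥2n/3 n e 2∣e (≤-trans (a≤d*⌈a/d⌉ (2 * n) 2) (*-monoʳ-≤ 3 ⌈2n/3⌉≤e))
  where open ≤-Reasoning

theorem1p1 : (n : ℕ) → 1 ≤ n →
    (μ[ n , 2 ]≡ ⌈ 2 * n / 3 ⌉)
    × (2 ≤ n →
    (μ*[ n , 2 ]≡ (2 * ⌈ n / 3 ⌉))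
    × (∀ k → μ[ n , 2 ]≡ k → IsLeast (λ e → 2 ∣ e × k ≤ e) (2 * ⌈ n / 3 ⌉)))
theorem1p1 n _ = μ-value n , λ 2≤n → μ*-value n 2≤n , λ k μ≡k →
  subst (λ k → IsLeast (λ e → 2 ∣ e × k ≤ e) (2 * ⌈ n / 3 ⌉))
    (isLeast-unique (μ-value n) μ≡k) (least-even n)
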